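{- Let $\epsilon < \frac{1}{23}$ be a real number. Let $G$ be a finite bipartite graph with bipartition $(L,R)$ such that every vertex of $L$ has degree at most $3$ and for every subset $A \subseteq L$, $|N_G(A)| \geq (2-\epsilon)|A|$. Then there exists a $(2,4)$-matching in $G$ covering $L$.
   Context: For a bipartite graph $G$ with bipartition $(L,R)$, a $(2,4)$-matching in $G$ is a subgraph $F$ of $G$ such that (1) each connected component of $F$ is a tree with at most $4$ edges, and (2) each vertex in $V(F)\cap L$ has degree exactly $2$ in $F$. A $(2,4)$-matching $F$ covers a set of vertices $S$ if $S \subseteq V(F)$. $N_G(A)$ denotes the set of neighbours in $G$ of vertices of $A$. -}

module Defs where

open import Data.Nat using (ℕ; zero; suc; _≤_)
open import Data.Bool using (Bool; true; false; _∧_; _∨_)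
open import Data.Fin using (Fin; zero; suc; inject₁; fromℕ)
open import Data.Fin.Subset using (Subset; ∣_∣)
open import Data.Vec using (Vec; tabulate; foldr)
open import Data.Sum using (_⊎_; inj₁; inj₂)
open import Data.Product using (_×_; Σ; proj₁; proj₂)
open import Data.Empty using (⊥)
open import Data.Integer using (+_)
open import Data.Rational using (ℚ; _/_; _-_; _*_; _<_) renaming (_≤_ to _≤ℚ_)
open import Function.Definitions using (Injective)
open import Relation.Binary.PropositionalEquality using (_≡_)

-- A finite bipartite graph with bipartition (L , R), L = Fin m, R = Fin n,
-- given by its (simple) edge relation as a Boolean matrix.
BipGraph : ℕ → ℕ → Set
BipGraph m n = Fin m → Fin n → Bool

degL : ∀ {m n} → BipGraph m n → Fin m → ℕ
degL E i = ∣ tabulate (λ j → E i j) ∣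

anyIn : ∀ {m} → Subset m → (Fin m → Bool) → Bool
anyIn {zero} A P = false
anyIn {suc m} (a Data.Vec.∷ A) P = (a ∧ P zero) ∨ anyIn A (λ i → P (suc i))

nbhd : ∀ {m n} → BipGraph m n → Subset m → Subset n
nbhd E A = tabulate (λ j → anyIn A (λ i → E i j))

SubgraphOf : ∀ {m n} → BipGraph m n → BipGraph m n → Set
SubgraphOf {m} {n} F E = (i : Fin m) (j : Fin n) → F i j ≡ true → E i j ≡ true

Vtx : ℕ → ℕ → Set
Vtx m n = Fin m ⊎ Fin n

Adj : ∀ {m n} → BipGraph m n → Vtx m n → Vtx m n → Set
Adj F (inj₁ i) (inj₂ j) = F i j ≡ true
Adj F (inj₂ j) (inj₁ i) = F i j ≡ true
Adj F (inj₁ _) (inj₁ _) = ⊥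
Adj F (inj₂ _) (inj₂ _) = ⊥

data Connected {m n} (F : BipGraph m n) : Vtx m n → Vtx m n → Set where
  here : ∀ {u} → Connected F u u
  step : ∀ {u v w} → Adj F u v → Connected F v w → Connected F u w

HasCycle : ∀ {m n} → BipGraph m n → Set
HasCycle {m} {n} F =
  Σ ℕ λ k → Σ (Fin (suc (suc (suc k))) → Vtx m n) λ c →
    Injective _≡_ _≡_ c
    × ((t : Fin (suc (suc k))) → Adj F (c (inject₁ t)) (c (suc t)))
    × Adj F (c (fromℕ (suc (suc k)))) (c zero)

ComponentsAtMost4Edges : ∀ {m n} → BipGraph m n → Set
ComponentsAtMost4Edges {m} {n} F =
  (v : Vtx m n) (e : Fin 5 → Fin m × Fin n) → Injective _≡_ _≡_ e →
  ((t : Fin 5) → (F (proj₁ (e t)) (proj₂ (e t)) ≡ true)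
                 × Connected F v (inj₁ (proj₁ (e t)))) → ⊥

-- A (2,4)-matching of G (edge set F) covering L: F is a subgraph of G, every
-- component of F is a tree (F acyclic) with at most 4 edges, and every vertex
-- of L lies in F and has degree exactly 2 in F.
Is24MatchingCoveringL : ∀ {m n} → BipGraph m n → BipGraph m n → Set
Is24MatchingCoveringL {m} E F =
  SubgraphOf F E
  × (HasCycle F → ⊥)
  × ComponentsAtMost4Edges F
  × ((i : Fin m) → degL F i ≡ 2)

ℕtoℚ : ℕ → ℚ
ℕtoℚ k = + k / 1

twoℚ : ℚ
twoℚ = + 2 / 1

oneOver23 : ℚ
oneOver23 = + 1 / 23

{-# OPTIONS --safe #-}

-- Call a vertex of R private to v ∈ L if v is its only neighbour.  Two local
-- configurations can be split off without affecting the hypothesis on the rest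
-- of the graph, as only vertices of L are deleted and the vertices of R used
-- have no other neighbour:
--   * a vertex of L with two private neighbours;
--   * two vertices of L sharing a neighbour of degree 2, each having a private
--     neighbour (they form a path with 4 edges).
-- If neither occurs, let every private edge have weight 5, every other edge
-- weight 2 or 3 according to whether or not its end in L has a private
-- neighbour.  A vertex of L then carries at most 9 and a vertex of R at least
-- 5, so 5 |N(L)| ≤ 9 |L|, which the hypothesis excludes (even for ε < 1/5).

module Submission where

open import Defs
open import Data.Nat using (ℕ; _≤_; zero; suc; z≤n; s≤s)
  renaming (_+_ to _+ℕ_; _*_ to _*ℕ_; _<_ to _<ℕ_)
import Data.Nat as ℕ
import Data.Nat.Properties as ℕ
open import Data.Bool using (Bool; true; false; if_then_else_)
open import Data.Bool.Properties using () renaming (_≟_ to _≟ᵇ_)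
open import Data.Fin using (Fin; zero; suc; _≟_; fromℕ; combine; punchIn; punchOut)
import Data.Fin.Properties as Fin
open import Data.Fin.Subset using (Subset; ∣_∣; _∈_; _∉_; _⊆_; Nonempty; ⁅_⁆; _∪_; _─_; ⊤)
open import Data.Fin.Subset.Properties
  using (_∈?_; nonempty?; x∈⁅x⁆; x∈⁅y⁆⇒x≡y; x∈p∪q⁺; x∈p∪q⁻; x∈p∩q⁺; x∈p∧x∉q⇒x∈p─q; p─q⊆p; p∩q≢∅⇒p─q⊂p; x∈p⇒∣p-x∣<∣p∣; ∈⊤)
open import Data.Fin.Subset.Induction using (⊂-wellFounded)
open import Data.Integer using (+_)
import Data.Integer as ℤ
import Data.Integer.Properties as ℤ
open import Data.Product using (Σ; _×_; _,_; ∃; ∃₂; proj₁; proj₂)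
open import Data.Rational using (ℚ; _-_; _*_; _<_; toℚᵘ) renaming (_≤_ to _≤ℚ_)
import Data.Rational.Properties as ℚ
open import Data.Rational.Unnormalised as ℚᵘ using (mkℚᵘ)
import Data.Rational.Unnormalised.Properties as ℚᵘ
open import Data.Sum using (_⊎_; inj₁; inj₂; [_,_]′)
open import Data.Vec using (_∷_; lookup; tabulate; here; there)
open import Data.Vec.Properties using (tabulate∘lookup; []=⇒lookup)
open import Algebra.Properties.CommutativeMonoid.Sum ℕ.+-0-commutativeMonoid
  using (sum; sum-cong-≗; sum-replicate-zero; sum-remove; ∑-distrib-+; ∑-comm)
open import Algebra.Properties.Semiring.Sum ℕ.+-*-semiring using (*-distribˡ-sum)
open import Function using (_∘_; case_of_)
open import Induction.WellFounded using (Acc; acc)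
open import Relation.Binary.PropositionalEquality
open import Relation.Nullary using (¬_; Dec; yes; no; does; contradiction)
open import Relation.Nullary.Decidable using (_×-dec_; _⊎-dec_; _→-dec_; ¬?; dec-true; dec-false)

private
  variable
    m n : ℕ

-- Sums over Fin

sum-mono-≤ : {f g : Fin n → ℕ} → (∀ i → f i ≤ g i) → sum f ≤ sum g
sum-mono-≤ {zero}  f≤g = z≤n
sum-mono-≤ {suc n} f≤g = ℕ.+-mono-≤ (f≤g zero) (sum-mono-≤ (f≤g ∘ suc))

term≤sum : (f : Fin n → ℕ) (i : Fin n) → f i ≤ sum f
term≤sum {suc n} f i rewrite sum-remove {i = i} f = ℕ.m≤m+n (f i) _

two-terms≤sum : (f : Fin n → ℕ) {i j : Fin n} → i ≢ j → f i +ℕ f j ≤ sum f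
two-terms≤sum {suc n} f {i} {j} i≢j rewrite sum-remove {i = i} f =
  ℕ.+-monoʳ-≤ (f i)
    (subst (λ k → f k ≤ sum (f ∘ punchIn i)) (Fin.punchIn-punchOut i≢j)
      (term≤sum (f ∘ punchIn i) (punchOut i≢j)))

-- Once `i` is removed, `punchOut` keeps `j` and `k` distinct among the remaining indices, which
-- reduces the claim to two terms.
three-terms≤sum : (f : Fin n → ℕ) {i j k : Fin n} → i ≢ j → i ≢ k → j ≢ k →
  f i +ℕ (f j +ℕ f k) ≤ sum f
three-terms≤sum {suc n} f {i} {j} {k} i≢j i≢k j≢k rewrite sum-remove {i = i} f =
  ℕ.+-monoʳ-≤ (f i)
    (subst₂ (λ x y → f x +ℕ f y ≤ sum (f ∘ punchIn i))
      (Fin.punchIn-punchOut i≢j) (Fin.punchIn-punchOut i≢k)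
      (two-terms≤sum (f ∘ punchIn i) (j≢k ∘ Fin.punchOut-injective i≢j i≢k)))

-- Cardinalities as sums of indicators

𝟙 : Bool → ℕ
𝟙 b = if b then 1 else 0

δ : Fin n → Fin n → ℕ
δ i j = 𝟙 (does (j ≟ i))

sum-δ : (i : Fin n) → sum (δ i) ≡ 1
sum-δ {suc n} zero    = cong suc (sum-replicate-zero n)
sum-δ         (suc i) = sum-δ i

∣tabulate∣ : (f : Fin n → Bool) → ∣ tabulate f ∣ ≡ sum (𝟙 ∘ f)
∣tabulate∣ {zero}  f = refl
∣tabulate∣ {suc n} f with f zero
... | true  = cong suc (∣tabulate∣ (f ∘ suc))
... | false = ∣tabulate∣ (f ∘ suc)

∣lookup∣ : (A : Subset n) → ∣ A ∣ ≡ sum (𝟙 ∘ lookup A)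
∣lookup∣ A = trans (cong ∣_∣ (sym (tabulate∘lookup A))) (∣tabulate∣ (lookup A))

anyIn⁻ : (A : Subset m) {P : Fin m → Bool} → anyIn A P ≡ true → ∃ λ i → i ∈ A × P i ≡ true
anyIn⁻ (a ∷ A) {P} eq with a | P zero in P0
... | true  | true  = zero , here , P0
... | true  | false = let i , i∈A , Pi = anyIn⁻ A eq in suc i , there i∈A , Pi
... | false | _     = let i , i∈A , Pi = anyIn⁻ A eq in suc i , there i∈A , Pi

does⇒ : ∀ {P : Set} (P? : Dec P) → does P? ≡ true → P
does⇒ (yes p) _ = p

-- The components of a cover are cherries centred in A and pairs of such
-- cherries with exactly one common leaf: any vertex of L shares at most one
-- neighbour r, with at most one other vertex of L.
record Cover (E : BipGraph m n) (A : Subset m) (F : BipGraph m n) : Set where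
  field
    within  : ∀ {i j} → F i j ≡ true → i ∈ A
    edge    : ∀ {i j} → F i j ≡ true → E i j ≡ true
    ends    : ∀ {i} → i ∈ A → ∃₂ λ p q → p ≢ q × F i p ≡ true × F i q ≡ true
                × (∀ {j} → F i j ≡ true → j ≡ p ⊎ j ≡ q)
    sharing : ∀ {u v w r s} → F u r ≡ true → F v r ≡ true → v ≢ u →
                F u s ≡ true → F w s ≡ true → w ≢ u → r ≡ s × v ≡ w

-- Covers of all of `L` are (2,4)-matchings

module _ {E F : BipGraph m n} (cover : Cover E ⊤ F) where
  open Cover cover

  -- As `p` and `q` are distinct, the indicator of row `i` splits into `δ p` and `δ q`, each of
  -- total 1.
  degL≡2 : ∀ i → degL F i ≡ 2
  degL≡2 i with p , q , p≢q , Fp , Fq , only ← ends {i} ∈⊤ = begin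
    degL F i                     ≡⟨ ∣tabulate∣ (F i) ⟩
    sum (𝟙 ∘ F i)                ≡⟨ sum-cong-≗ split ⟩
    sum (λ j → δ p j +ℕ δ q j)   ≡⟨ ∑-distrib-+ (δ p) (δ q) ⟩
    sum (δ p) +ℕ sum (δ q)       ≡⟨ cong₂ _+ℕ_ (sum-δ p) (sum-δ q) ⟩
    2                            ∎
    where
    open ≡-Reasoning
    split : ∀ j → 𝟙 (F i j) ≡ δ p j +ℕ δ q j
    split j with j ≟ p | j ≟ q | F i j in Fj
    ... | yes j≡p | yes j≡q | _     = contradiction (trans (sym j≡p) j≡q) p≢q
    ... | yes _   | no _    | true  = refl
    ... | yes j≡p | no _    | false = case trans (sym Fj) (trans (cong (F i) j≡p) Fp) of λ ()
    ... | no _    | yes _   | true  = refl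
    ... | no _    | yes j≡q | false = case trans (sym Fj) (trans (cong (F i) j≡q) Fq) of λ ()
    ... | no j≢p  | no j≢q  | true  = contradiction (only Fj) [ j≢p , j≢q ]′
    ... | no _    | no _    | false = refl

  -- The tool against cycles: `c` lies in `L` and shares `b` with `a` and `d` with `e`, so `sharing`
  -- identifies `b` and `d`. The ends `a` and `e` may coincide, as they do in a 4-cycle.
  window : ∀ {a b c d e : Vtx _ _} {v} → c ≡ inj₁ v →
    Adj F a b → Adj F b c → Adj F c d → Adj F d e → a ≢ c → e ≢ c → b ≡ d
  window {inj₁ _} {inj₂ _} {inj₁ _} {inj₂ _} {inj₁ _} _ ab bc cd de a≢c e≢c =
    cong inj₂ (proj₁ (sharing bc ab (a≢c ∘ cong inj₁) cd de (e≢c ∘ cong inj₁)))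
  window {b = inj₁ _} refl _ () _ _ _ _
  window {d = inj₁ _} refl _ _ () _ _ _
  window {inj₂ _} {inj₂ _} _ () _ _ _ _ _
  window {d = inj₂ _} {inj₂ _} _ _ _ _ () _ _

  acyclic : ¬ HasCycle F
  acyclic (k , c , inj , adj , close) with c zero in c₀
  -- The window has indices `k + 1`, `k + 2`, 0, 1, 2; it would identify the vertices at `k + 2` and
  -- 1.
  ... | inj₁ _ = case inj (window c₀ (adj (fromℕ (suc k))) close′ (adj zero) (adj (suc zero))
                   (λ eq → case inj eq of λ ()) (λ eq → case inj eq of λ ())) of λ ()
    where
    close′ : Adj F (c (fromℕ (suc (suc k)))) (c zero)
    close′ = subst (Adj F _) (sym c₀) close
  ... | inj₂ _ with c (suc zero) in c₁ | adj zero
  ...   | inj₂ _ | a = case subst (λ x → Adj F x _) c₀ a of λ ()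
  -- Now index 1 is the one in `L`, and the window is `k + 2`, 0, 1, 2, 3. For `k = 0` the index 3
  -- wraps round to 0.
  ...   | inj₁ _ | a with k
  ...     | zero  = case inj (window c₁ close′ adj₀ (adj (suc zero)) close′
                      (λ eq → case inj eq of λ ()) (λ eq → case inj eq of λ ())) of λ ()
    where
    close′ : Adj F (c (suc (suc zero))) (c zero)
    close′ = subst (Adj F _) (sym c₀) close
    adj₀ : Adj F (c zero) (c (suc zero))
    adj₀ = subst (Adj F _) (sym c₁) a
  ...     | suc _ = case inj (window c₁ close′ adj₀ (adj (suc zero)) (adj (suc (suc zero)))
                      (λ eq → case inj eq of λ ()) (λ eq → case inj eq of λ ())) of λ ()
    where
    close′ : Adj F (c (suc (suc (fromℕ _)))) (c zero)
    close′ = subst (Adj F _) (sym c₀) close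
    adj₀ : Adj F (c zero) (c (suc zero))
    adj₀ = subst (Adj F _) (sym c₁) a

  Adj-sym : ∀ {x y} → Adj F x y → Adj F y x
  Adj-sym {inj₁ _} {inj₂ _} xy = xy
  Adj-sym {inj₂ _} {inj₁ _} xy = xy

  Connected-trans : ∀ {x y z} → Connected F x y → Connected F y z → Connected F x z
  Connected-trans here       yz = yz
  Connected-trans (step a p) yz = step a (Connected-trans p yz)

  Connected-sym : ∀ {x y} → Connected F x y → Connected F y x
  Connected-sym here       = here
  Connected-sym (step a p) = Connected-trans (Connected-sym p) (step (Adj-sym a) here)

  Partner : Fin _ → Fin _ → Set
  Partner a b = b ≢ a × ∃ λ r → F a r ≡ true × F b r ≡ true

  partner-unique : ∀ {a b c} → Partner a b → Partner a c → b ≡ c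
  partner-unique (b≢a , _ , ar , br) (c≢a , _ , as , cs) =
    proj₂ (sharing ar br b≢a as cs c≢a)

  -- A hop from `a` leads to a partner by definition. A hop from a partner `b` to a third vertex
  -- would give `b` two partners, that vertex and `a`.
  two-step : ∀ {a b c s} → b ≡ a ⊎ Partner a b → F b s ≡ true → F c s ≡ true →
    c ≡ a ⊎ Partner a c
  two-step {a} {b} {c} {s} a~b bs cs with c ≟ a | c ≟ b
  ... | yes c≡a | _        = inj₁ c≡a
  ... | no _    | yes refl = a~b
  ... | no c≢a  | no c≢b with a~b
  ...   | inj₁ refl = inj₂ (c≢a , s , bs , cs)
  ...   | inj₂ (b≢a , r , ar , br) =
    contradiction (partner-unique (c≢b , s , bs , cs) (b≢a ∘ sym , r , br , ar)) c≢a

  -- A path between vertices of `L` splits into hops through `R`, so the component of `a` meets `L`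
  -- only in `a` and its one possible partner.
  component : ∀ {a b c} → b ≡ a ⊎ Partner a b → Connected F (inj₁ b) (inj₁ c) →
    c ≡ a ⊎ Partner a c
  component a~b here = a~b
  component a~b (step {v = inj₂ _} bs (step {v = inj₁ _} cs p)) =
    component (two-step a~b bs cs) p

  -- A component has at most two centres, each with two edges. An edge is thus determined by a code
  -- in `Fin 2 × Fin 2`, and among five edges two share a code.
  small-components : ComponentsAtMost4Edges F
  small-components v e inj in-component =
    let t , t′ , t<t′ , same = Fin.pigeonhole (ℕ.n<1+n 4) (λ t → combine (centre t) (end t))
        centre≡ , end≡ = Fin.combine-injective (centre t) (end t) (centre t′) (end t′) same
    in Fin.<⇒≢ t<t′ (inj (edge≡ t t′ centre≡ end≡))
    where
    i : Fin 5 → Fin _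
    i t = proj₁ (e t)

    j : Fin 5 → Fin _
    j t = proj₂ (e t)

    -- The given `v` may lie in `R`, so the centre of the first edge serves as the reference vertex.
    near : ∀ t → i t ≡ i zero ⊎ Partner (i zero) (i t)
    near t = component (inj₁ refl)
      (Connected-trans (Connected-sym (proj₂ (in-component zero))) (proj₂ (in-component t)))

    centre : Fin 5 → Fin 2
    centre t = [ (λ _ → zero) , (λ _ → suc zero) ]′ (near t)

    p : Fin _ → Fin _
    p u = proj₁ (ends {u} ∈⊤)

    q : Fin _ → Fin _
    q u = proj₁ (proj₂ (ends {u} ∈⊤))

    other : ∀ {u x} → F u x ≡ true → x ≢ p u → x ≡ q u
    other {u} Fux x≢p with _ , _ , _ , _ , _ , only ← ends {u} ∈⊤ =
      [ (λ x≡p → contradiction x≡p x≢p) , (λ x≡q → x≡q) ]′ (only Fux)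

    end : Fin 5 → Fin 2
    end t = if does (j t ≟ p (i t)) then zero else suc zero

    i≡ : ∀ t t′ → centre t ≡ centre t′ → i t ≡ i t′
    i≡ t t′ eq with near t | near t′
    ... | inj₁ x | inj₁ y = trans x (sym y)
    ... | inj₂ x | inj₂ y = partner-unique x y

    j≡ : ∀ t t′ → i t ≡ i t′ → end t ≡ end t′ → j t ≡ j t′
    j≡ t t′ it≡it′ eq with j t ≟ p (i t) | j t′ ≟ p (i t′)
    ... | yes x | yes y = trans x (trans (cong p it≡it′) (sym y))
    ... | no x  | no y  =
      trans (other (proj₁ (in-component t)) x)
        (trans (cong q it≡it′) (sym (other (proj₁ (in-component t′)) y)))

    edge≡ : ∀ t t′ → centre t ≡ centre t′ → end t ≡ end t′ → e t ≡ e t′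
    edge≡ t t′ c≡ e≡ = cong₂ _,_ (i≡ t t′ c≡) (j≡ t t′ (i≡ t t′ c≡) e≡)

-- Gluing a cover of `S` to a cover of the rest

-- Rows in `S` come from `H`, the others from `F`. By the last hypothesis no vertex of `R` is used
-- by both, so nothing is shared across the two parts and `sharing` is inherited from each.
glue : ∀ {E H F : BipGraph m n} {A S} → S ⊆ A → Cover E S H → Cover E (A ─ S) F →
  (∀ {i j k} → H i j ≡ true → k ∈ A → E k j ≡ true → k ∈ S) →
  ∃ λ F′ → Cover E A F′
glue {m = m} {n = n} {E = E} {H = H} {F = F} {A = A} {S = S} S⊆A coverH coverF isolated = F′ , record
  { within  = λ {i} → within i
  ; edge    = λ {i} → edge i
  ; ends    = ends
  ; sharing = sharing
  }
  where
  module H = Cover coverH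
  module F = Cover coverF

  F′ : BipGraph m n
  F′ i j = if does (i ∈? S) then H i j else F i j

  inside : ∀ {i} → i ∈ S → ∀ j → F′ i j ≡ H i j
  inside {i} i∈S j rewrite dec-true (i ∈? S) i∈S = refl

  outside : ∀ {i} → i ∉ S → ∀ j → F′ i j ≡ F i j
  outside {i} i∉S j rewrite dec-false (i ∈? S) i∉S = refl

  within : ∀ i {j} → F′ i j ≡ true → i ∈ A
  within i eq with i ∈? S
  ... | yes i∈S = S⊆A i∈S
  ... | no _    = p─q⊆p A S (F.within eq)

  edge : ∀ i {j} → F′ i j ≡ true → E i j ≡ true
  edge i eq with i ∈? S
  ... | yes _ = H.edge eq
  ... | no _  = F.edge eq

  ends : ∀ {i} → i ∈ A → ∃₂ λ p q → p ≢ q × F′ i p ≡ true × F′ i q ≡ true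
           × (∀ {j} → F′ i j ≡ true → j ≡ p ⊎ j ≡ q)
  ends {i} i∈A with i ∈? S
  ... | yes i∈S = H.ends i∈S
  ... | no i∉S  = F.ends (x∈p∧x∉q⇒x∈p─q i∈A i∉S)

  -- The vertex `r` is used by `H` at `u`, so `isolated` puts every neighbour of `r` in `A`, in
  -- particular `v`, into `S`.
  same-side : ∀ {u v r} → F′ u r ≡ true → F′ v r ≡ true → u ∈ S → v ∈ S
  same-side {v = v} {r} ur vr u∈S =
    isolated (trans (sym (inside u∈S r)) ur) (within v vr) (edge v vr)

  sharing : ∀ {u v w r s} → F′ u r ≡ true → F′ v r ≡ true → v ≢ u →
    F′ u s ≡ true → F′ w s ≡ true → w ≢ u → r ≡ s × v ≡ w
  sharing {u} {r = r} {s} ur vr v≢u us ws w≢u = case u ∈? S of λ where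
    (yes u∈S) → H.sharing
      (trans (sym (inside u∈S r)) ur)
      (trans (sym (inside (same-side ur vr u∈S) r)) vr) v≢u
      (trans (sym (inside u∈S s)) us)
      (trans (sym (inside (same-side us ws u∈S) s)) ws) w≢u
    -- The contrapositive of `same-side`: a neighbour in `S` would pull `u` into `S`.
    (no u∉S) → F.sharing
      (trans (sym (outside u∉S r)) ur)
      (trans (sym (outside (u∉S ∘ same-side vr ur) r)) vr) v≢u
      (trans (sym (outside u∉S s)) us)
      (trans (sym (outside (u∉S ∘ same-side ws us) s)) ws) w≢u

-- The two configurations that can be split off

module Reduction (E : BipGraph m n) (A : Subset m) where

  -- Privacy is relative to the current `A`: vertices of `L` already deleted do not count as
  -- neighbours.
  Private : Fin m → Fin n → Set
  Private i j = E i j ≡ true × (∀ k → k ∈ A → E k j ≡ true → k ≡ i)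

  private? : ∀ i j → Dec (Private i j)
  private? i j = (E i j ≟ᵇ true) ×-dec
    Fin.all? (λ k → (k ∈? A) →-dec ((E k j ≟ᵇ true) →-dec (k ≟ i)))

  HasPrivate : Fin m → Set
  HasPrivate i = ∃ (Private i)

  hasPrivate? : ∀ i → Dec (HasPrivate i)
  hasPrivate? i = Fin.any? (private? i)

  TwoPrivate : Set
  TwoPrivate = ∃ λ i → i ∈ A × ∃₂ λ p q → p ≢ q × Private i p × Private i q

  twoPrivate? : Dec TwoPrivate
  twoPrivate? = Fin.any? λ i → (i ∈? A) ×-dec Fin.any? λ p → Fin.any? λ q →
    ¬? (p ≟ q) ×-dec private? i p ×-dec private? i q

  SharedPair : Set
  SharedPair = ∃₂ λ i i′ → i ≢ i′ × i ∈ A × i′ ∈ A × HasPrivate i × HasPrivate i′ ×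
    ∃ λ r → E i r ≡ true × E i′ r ≡ true × (∀ k → k ∈ A → E k r ≡ true → k ≡ i ⊎ k ≡ i′)

  sharedPair? : Dec SharedPair
  sharedPair? = Fin.any? λ i → Fin.any? λ i′ →
    ¬? (i ≟ i′) ×-dec (i ∈? A) ×-dec (i′ ∈? A) ×-dec hasPrivate? i ×-dec hasPrivate? i′ ×-dec
    Fin.any? λ r → (E i r ≟ᵇ true) ×-dec (E i′ r ≟ᵇ true) ×-dec
    Fin.all? λ k → (k ∈? A) →-dec ((E k r ≟ᵇ true) →-dec ((k ≟ i) ⊎-dec (k ≟ i′)))

  -- The data that `glue` asks of the split-off part, with nonemptiness so that `A ─ S` is strictly
  -- smaller.
  record Removable : Set where
    field
      S        : Subset m
      nonempty : Nonempty S
      S⊆A      : S ⊆ A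
      H        : BipGraph m n
      cover    : Cover E S H
      isolated : ∀ {i j k} → H i j ≡ true → k ∈ A → E k j ≡ true → k ∈ S

  -- The part is the cherry `p`, `i`, `q`. Its only centre is `i`, which makes `sharing` vacuous,
  -- and privacy of both leaves gives `isolated`.
  twoPrivate⇒removable : TwoPrivate → Removable
  twoPrivate⇒removable (i , i∈A , p , q , p≢q , (ip , p-priv) , (iq , q-priv)) = record
    { S        = ⁅ i ⁆
    ; nonempty = i , x∈⁅x⁆ i
    ; S⊆A      = λ k∈S → subst (_∈ A) (sym (x∈⁅y⁆⇒x≡y i k∈S)) i∈A
    ; H        = λ k j → does (H? k j)
    ; cover    = record
      { within  = λ {k} {j} kj → case does⇒ (H? k j) kj of λ where
          (refl , _) → x∈⁅x⁆ i
      ; edge    = λ {k} {j} kj → case does⇒ (H? k j) kj of λ where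
          (refl , inj₁ refl) → ip
          (refl , inj₂ refl) → iq
      ; ends    = λ {k} k∈S → let k≡i = x∈⁅y⁆⇒x≡y i k∈S in
          p , q , p≢q , dec-true (H? k p) (k≡i , inj₁ refl) , dec-true (H? k q) (k≡i , inj₂ refl)
          , λ {j} kj → proj₂ (does⇒ (H? k j) kj)
      ; sharing = λ {u} {v} {w} {r} ur vr v≢u _ _ _ →
          contradiction (trans (proj₁ (does⇒ (H? v r) vr)) (sym (proj₁ (does⇒ (H? u r) ur)))) v≢u
      }
    ; isolated = λ {i′} {j} {k} ij k∈A kj → case does⇒ (H? i′ j) ij of λ where
        (refl , inj₁ refl) → subst (_∈ ⁅ i ⁆) (sym (p-priv k k∈A kj)) (x∈⁅x⁆ i)
        (refl , inj₂ refl) → subst (_∈ ⁅ i ⁆) (sym (q-priv k k∈A kj)) (x∈⁅x⁆ i)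
    }
    where
    H? : ∀ k j → Dec (k ≡ i × (j ≡ p ⊎ j ≡ q))
    H? k j = (k ≟ i) ×-dec ((j ≟ p) ⊎-dec (j ≟ q))

  -- The part is the path `p`, `i`, `r`, `i′`, `p′`. Only `r` is shared, and only between `i` and
  -- `i′`.
  sharedPair⇒removable : SharedPair → Removable
  sharedPair⇒removable
    (i , i′ , i≢i′ , i∈A , i′∈A , (p , ip , p-priv) , (p′ , i′p′ , p′-priv) , r , ir , i′r , r-priv) =
    record
    { S        = S
    ; nonempty = i , i∈S
    ; S⊆A      = λ k∈S → case S⁻ k∈S of λ where
        (inj₁ refl) → i∈A
        (inj₂ refl) → i′∈A
    ; H        = λ k j → does (H? k j)
    ; cover    = record
      { within  = λ {k} {j} kj → case does⇒ (H? k j) kj of λ where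
          (inj₁ (refl , _)) → i∈S
          (inj₂ (refl , _)) → i′∈S
      ; edge    = λ {k} {j} kj → edge (does⇒ (H? k j) kj)
      ; ends    = λ k∈S → ends (S⁻ k∈S)
      ; sharing = λ {u} {v} {w} {x} {y} ux vx v≢u uy wy w≢u →
          same (common (does⇒ (H? u x) ux) (does⇒ (H? v x) vx) v≢u)
               (common (does⇒ (H? u y) uy) (does⇒ (H? w y) wy) w≢u)
      }
    ; isolated = λ {k} {j} {l} kj l∈A lj → case does⇒ (H? k j) kj of λ where
        (inj₁ (_ , inj₁ refl)) → S⁺ (inj₁ (p-priv l l∈A lj))
        (inj₁ (_ , inj₂ refl)) → S⁺ (r-priv l l∈A lj)
        (inj₂ (_ , inj₁ refl)) → S⁺ (inj₂ (p′-priv l l∈A lj))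
        (inj₂ (_ , inj₂ refl)) → S⁺ (r-priv l l∈A lj)
    }
    where
    S : Subset m
    S = ⁅ i ⁆ ∪ ⁅ i′ ⁆

    S⁺ : ∀ {k} → k ≡ i ⊎ k ≡ i′ → k ∈ S
    S⁺ (inj₁ refl) = x∈p∪q⁺ (inj₁ (x∈⁅x⁆ i))
    S⁺ (inj₂ refl) = x∈p∪q⁺ {p = ⁅ i ⁆} (inj₂ (x∈⁅x⁆ i′))

    i∈S : i ∈ S
    i∈S = S⁺ (inj₁ refl)

    i′∈S : i′ ∈ S
    i′∈S = S⁺ (inj₂ refl)

    S⁻ : ∀ {k} → k ∈ S → k ≡ i ⊎ k ≡ i′
    S⁻ k∈S with x∈p∪q⁻ ⁅ i ⁆ ⁅ i′ ⁆ k∈S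
    ... | inj₁ k∈ = inj₁ (x∈⁅y⁆⇒x≡y i k∈)
    ... | inj₂ k∈ = inj₂ (x∈⁅y⁆⇒x≡y i′ k∈)

    Path : Fin m → Fin n → Set
    Path k j = (k ≡ i × (j ≡ p ⊎ j ≡ r)) ⊎ (k ≡ i′ × (j ≡ p′ ⊎ j ≡ r))

    H? : ∀ k j → Dec (Path k j)
    H? k j = ((k ≟ i) ×-dec ((j ≟ p) ⊎-dec (j ≟ r))) ⊎-dec ((k ≟ i′) ×-dec ((j ≟ p′) ⊎-dec (j ≟ r)))

    edge : ∀ {k j} → Path k j → E k j ≡ true
    edge (inj₁ (refl , inj₁ refl)) = ip
    edge (inj₁ (refl , inj₂ refl)) = ir
    edge (inj₂ (refl , inj₁ refl)) = i′p′
    edge (inj₂ (refl , inj₂ refl)) = i′r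

    ends : ∀ {k} → k ≡ i ⊎ k ≡ i′ → ∃₂ λ x y → x ≢ y × does (H? k x) ≡ true × does (H? k y) ≡ true
             × (∀ {j} → does (H? k j) ≡ true → j ≡ x ⊎ j ≡ y)
    -- If `p` were `r`, then `i′` would be a second neighbour of the private vertex `p`.
    ends (inj₁ refl) = p , r , (λ p≡r → i≢i′ (sym (p-priv i′ i′∈A (subst (λ x → E i′ x ≡ true) (sym p≡r) i′r))))
      , dec-true (H? i p) (inj₁ (refl , inj₁ refl)) , dec-true (H? i r) (inj₁ (refl , inj₂ refl))
      , λ {j} ij → case does⇒ (H? i j) ij of λ where
          (inj₁ (_ , j≡))   → j≡
          (inj₂ (i≡i′ , _)) → contradiction i≡i′ i≢i′
    ends (inj₂ refl) = p′ , r , (λ p≡r → i≢i′ (p′-priv i i∈A (subst (λ x → E i x ≡ true) (sym p≡r) ir)))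
      , dec-true (H? i′ p′) (inj₂ (refl , inj₁ refl)) , dec-true (H? i′ r) (inj₂ (refl , inj₂ refl))
      , λ {j} ij → case does⇒ (H? i′ j) ij of λ where
          (inj₁ (i′≡i , _)) → contradiction (sym i′≡i) i≢i′
          (inj₂ (_ , j≡))   → j≡

    Opposite : Fin m → Fin m → Set
    Opposite u v = (u ≡ i × v ≡ i′) ⊎ (u ≡ i′ × v ≡ i)

    -- Distinct centres are `i` and `i′` in some order; a private end cannot be common to both,
    -- which leaves `r`.
    common : ∀ {u v x} → Path u x → Path v x → v ≢ u → x ≡ r × Opposite u v
    common (inj₁ (refl , _)) (inj₁ (refl , _)) v≢u = contradiction refl v≢u
    common (inj₂ (refl , _)) (inj₂ (refl , _)) v≢u = contradiction refl v≢u
    common (inj₁ (refl , inj₂ x≡r)) (inj₂ (refl , _)) _ = x≡r , inj₁ (refl , refl)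
    common (inj₂ (refl , inj₂ x≡r)) (inj₁ (refl , _)) _ = x≡r , inj₂ (refl , refl)
    common (inj₁ (refl , inj₁ refl)) v@(inj₂ (refl , _)) v≢u =
      contradiction (p-priv i′ i′∈A (edge v)) v≢u
    common (inj₂ (refl , inj₁ refl)) v@(inj₁ (refl , _)) v≢u =
      contradiction (p′-priv i i∈A (edge v)) v≢u

    same : ∀ {u v w x y} → x ≡ r × Opposite u v → y ≡ r × Opposite u w → x ≡ y × v ≡ w
    same (x≡r , o) (y≡r , o′) = trans x≡r (sym y≡r) , opposite-unique o o′
      where
      opposite-unique : ∀ {u v w} → Opposite u v → Opposite u w → v ≡ w
      opposite-unique (inj₁ (_ , v≡)) (inj₁ (_ , w≡)) = trans v≡ (sym w≡)
      opposite-unique (inj₂ (_ , v≡)) (inj₂ (_ , w≡)) = trans v≡ (sym w≡)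
      opposite-unique (inj₁ (u≡i , _)) (inj₂ (u≡i′ , _)) = contradiction (trans (sym u≡i) u≡i′) i≢i′
      opposite-unique (inj₂ (u≡i′ , _)) (inj₁ (u≡i , _)) = contradiction (trans (sym u≡i) u≡i′) i≢i′

-- Discharging when neither configuration occurs

module Discharging (E : BipGraph m n) (A : Subset m) (degree : ∀ i → degL E i ≤ 3)
  (¬twoPrivate : ¬ Reduction.TwoPrivate E A) (¬sharedPair : ¬ Reduction.SharedPair E A) where

  open Reduction E A

  -- The values balance: rows give at most 5 + 2 + 2 = 3 + 3 + 3 = 9, columns at least 5, 2 + 3 or 2
  -- + 2 + 2. Weight 0 off the edges at `A` lets sums run over all indices.
  weight : Fin m → Fin n → ℕ
  weight i j with i ∈? A | E i j ≟ᵇ true | private? i j | hasPrivate? i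
  ... | no _  | _     | _     | _     = 0
  ... | yes _ | no _  | _     | _     = 0
  ... | yes _ | yes _ | yes _ | _     = 5
  ... | yes _ | yes _ | no _  | yes _ = 2
  ... | yes _ | yes _ | no _  | no _  = 3

  2≤weight : ∀ {i j} → i ∈ A → E i j ≡ true → 2 ≤ weight i j
  2≤weight {i} {j} i∈A ij with i ∈? A | E i j ≟ᵇ true | private? i j | hasPrivate? i
  ... | no i∉A | _      | _     | _     = contradiction i∈A i∉A
  ... | yes _  | no ¬ij | _     | _     = contradiction ij ¬ij
  ... | yes _  | yes _  | yes _ | _     = ℕ.m≤m+n 2 3
  ... | yes _  | yes _  | no _  | yes _ = ℕ.≤-refl
  ... | yes _  | yes _  | no _  | no _  = ℕ.m≤m+n 2 1

  3≤weight : ∀ {i j} → i ∈ A → E i j ≡ true → ¬ HasPrivate i → 3 ≤ weight i j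
  3≤weight {i} {j} i∈A ij none with i ∈? A | E i j ≟ᵇ true | private? i j | hasPrivate? i
  ... | no i∉A | _      | _     | _        = contradiction i∈A i∉A
  ... | yes _  | no ¬ij | _     | _        = contradiction ij ¬ij
  ... | yes _  | yes _  | yes p | _        = contradiction (j , p) none
  ... | yes _  | yes _  | no _  | yes some = contradiction some none
  ... | yes _  | yes _  | no _  | no _     = ℕ.≤-refl

  5≤weight : ∀ {i j} → i ∈ A → Private i j → 5 ≤ weight i j
  5≤weight {i} {j} i∈A p with i ∈? A | E i j ≟ᵇ true | private? i j | hasPrivate? i
  ... | no i∉A | _      | _     | _ = contradiction i∈A i∉A
  ... | yes _  | no ¬ij | _     | _ = contradiction (proj₁ p) ¬ij
  ... | yes _  | yes _  | yes _ | _ = ℕ.≤-refl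
  ... | yes _  | yes _  | no ¬p | _ = contradiction p ¬p

  weight-∉ : ∀ {i} j → i ∉ A → weight i j ≤ 0
  weight-∉ {i} j i∉A with i ∈? A
  ... | no _    = z≤n
  ... | yes i∈A = contradiction i∈A i∉A

  -- By `¬twoPrivate` the edge to `p` is the only private one at `i`: it weighs 2 + 3, every other
  -- edge at most 2.
  weight≤-private : ∀ {i p} → Private i p → ∀ j → weight i j ≤ 2 *ℕ 𝟙 (E i j) +ℕ 3 *ℕ δ p j
  weight≤-private {i} {p} ip j with i ∈? A | E i j ≟ᵇ true | private? i j | hasPrivate? i
  ... | no _    | _      | _      | _       = z≤n
  ... | yes _   | no _   | _      | _       = z≤n
  ... | yes _   | yes _  | no _   | no none = contradiction (p , ip) none
  ... | yes _   | yes eq | no _   | yes _   rewrite eq = s≤s (s≤s z≤n)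
  ... | yes i∈A | yes eq | yes ij | _       with j ≟ p
  ...   | yes _  rewrite eq = ℕ.≤-refl
  ...   | no j≢p = contradiction (i , i∈A , j , p , j≢p , ij , ip) ¬twoPrivate

  weight≤-nonprivate : ∀ {i} → ¬ HasPrivate i → ∀ j → weight i j ≤ 3 *ℕ 𝟙 (E i j)
  weight≤-nonprivate {i} none j with i ∈? A | E i j ≟ᵇ true | private? i j | hasPrivate? i
  ... | no _    | _      | _      | _        = z≤n
  ... | yes _   | no _   | _      | _        = z≤n
  ... | yes _   | yes _  | yes ij | _        = contradiction (j , ij) none
  ... | yes _   | yes _  | no _   | yes some = contradiction some none
  ... | yes _   | yes eq | no _   | no _     rewrite eq = ℕ.≤-refl

  sum-edges≤ : ∀ c i → sum (λ j → c *ℕ 𝟙 (E i j)) ≤ c *ℕ 3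
  sum-edges≤ c i = begin
    sum (λ j → c *ℕ 𝟙 (E i j))  ≡⟨ *-distribˡ-sum c (𝟙 ∘ E i) ⟨
    c *ℕ sum (𝟙 ∘ E i)          ≡⟨ cong (c *ℕ_) (∣tabulate∣ (E i)) ⟨
    c *ℕ degL E i               ≤⟨ ℕ.*-monoʳ-≤ c (degree i) ⟩
    c *ℕ 3                      ∎
    where open ℕ.≤-Reasoning

  row≤9 : ∀ i → sum (weight i) ≤ 9
  row≤9 i = case hasPrivate? i of λ where
      (no none)      → ℕ.≤-trans (sum-mono-≤ (weight≤-nonprivate none)) (sum-edges≤ 3 i)
      (yes (p , ip)) → begin
        sum (weight i)
          ≤⟨ sum-mono-≤ (weight≤-private ip) ⟩
        sum (λ j → 2 *ℕ 𝟙 (E i j) +ℕ 3 *ℕ δ p j)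
          ≡⟨ ∑-distrib-+ (λ j → 2 *ℕ 𝟙 (E i j)) (λ j → 3 *ℕ δ p j) ⟩
        sum (λ j → 2 *ℕ 𝟙 (E i j)) +ℕ sum (λ j → 3 *ℕ δ p j)
          ≡⟨ cong (sum (λ j → 2 *ℕ 𝟙 (E i j)) +ℕ_)
               (trans (sym (*-distribˡ-sum 3 (δ p))) (cong (3 *ℕ_) (sum-δ p))) ⟩
        sum (λ j → 2 *ℕ 𝟙 (E i j)) +ℕ 3
          ≤⟨ ℕ.+-monoˡ-≤ 3 (sum-edges≤ 2 i) ⟩
        9 ∎
    where open ℕ.≤-Reasoning

  row≤ : ∀ i → sum (weight i) ≤ 9 *ℕ 𝟙 (lookup A i)
  row≤ i = case i ∈? A of λ where
    (yes i∈A) → subst (λ b → sum (weight i) ≤ 9 *ℕ 𝟙 b) (sym ([]=⇒lookup i∈A)) (row≤9 i)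
    (no i∉A)  → ℕ.≤-trans (sum-mono-≤ (λ j → weight-∉ j i∉A))
                  (subst (_≤ 9 *ℕ 𝟙 (lookup A i)) (sym (sum-replicate-zero n)) z≤n)

  -- Count the neighbours of `j` in `A`. A single one has a private edge of weight 5. Of exactly
  -- two, one has no private neighbour by `¬sharedPair`, giving 3 + 2. Three or more give at least
  -- 6.
  5≤column : ∀ {i j} → i ∈ A → E i j ≡ true → 5 ≤ sum (λ k → weight k j)
  5≤column {i} {j} i∈A ij = case Fin.any? (other? i i) of λ where
      (no ¬other) → ℕ.≤-trans
        (5≤weight i∈A (ij , λ k k∈A kj → [ (λ x → x) , (λ x → x) ]′ (none-other ¬other k∈A kj)))
        (term≤sum column i)
      (yes (i′ , i′∈A , i′j , i′≢i , _)) → case Fin.any? (other? i i′) of λ where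
        (yes (i″ , i″∈A , i″j , i″≢i , i″≢i′)) → begin
          5                                      ≤⟨ ℕ.n≤1+n 5 ⟩
          2 +ℕ (2 +ℕ 2)                          ≤⟨ ℕ.+-mono-≤ (2≤weight i∈A ij)
                                                      (ℕ.+-mono-≤ (2≤weight i′∈A i′j) (2≤weight i″∈A i″j)) ⟩
          column i +ℕ (column i′ +ℕ column i″)   ≤⟨ three-terms≤sum column (i′≢i ∘ sym) (i″≢i ∘ sym) (i″≢i′ ∘ sym) ⟩
          sum column                             ∎
        (no ¬other) → ℕ.≤-trans
          (case (hasPrivate? i , hasPrivate? i′) of λ where
            (no none , _)     → ℕ.+-mono-≤ (3≤weight i∈A ij none) (2≤weight i′∈A i′j)
            (yes _ , no none) → ℕ.+-mono-≤ (2≤weight i∈A ij) (3≤weight i′∈A i′j none)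
            (yes p , yes p′)  → contradiction
              (i , i′ , i′≢i ∘ sym , i∈A , i′∈A , p , p′ , j , ij , i′j , λ k → none-other ¬other) ¬sharedPair)
          (two-terms≤sum column (i′≢i ∘ sym))
    where
    open ℕ.≤-Reasoning

    column : Fin m → ℕ
    column k = weight k j

    -- Two exclusions serve both searches: `Other i i` looks for a second neighbour, `Other i i′`
    -- for a third.
    Other : Fin m → Fin m → Fin m → Set
    Other x y k = k ∈ A × E k j ≡ true × k ≢ x × k ≢ y

    other? : ∀ x y k → Dec (Other x y k)
    other? x y k = (k ∈? A) ×-dec (E k j ≟ᵇ true) ×-dec ¬? (k ≟ x) ×-dec ¬? (k ≟ y)

    none-other : ∀ {x y k} → ¬ ∃ (Other x y) → k ∈ A → E k j ≡ true → k ≡ x ⊎ k ≡ y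
    none-other {x} {y} {k} ¬other k∈A kj with k ≟ x | k ≟ y
    ... | yes k≡x | _       = inj₁ k≡x
    ... | no _    | yes k≡y = inj₂ k≡y
    ... | no k≢x  | no k≢y  = contradiction (k , k∈A , kj , k≢x , k≢y) ¬other

  column≥ : ∀ j → 5 *ℕ 𝟙 (anyIn A (λ i → E i j)) ≤ sum (λ i → weight i j)
  column≥ j with anyIn A (λ i → E i j) in eq
  ... | false = z≤n
  ... | true  = let i , i∈A , ij = anyIn⁻ A eq in 5≤column i∈A ij

  -- Double counting of the total weight, by columns from below and by rows from above.
  5∣nbhd∣≤9∣A∣ : 5 *ℕ ∣ nbhd E A ∣ ≤ 9 *ℕ ∣ A ∣
  5∣nbhd∣≤9∣A∣ = begin
    5 *ℕ ∣ nbhd E A ∣                              ≡⟨ cong (5 *ℕ_) (∣tabulate∣ (λ j → anyIn A (λ i → E i j))) ⟩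
    5 *ℕ sum (λ j → 𝟙 (anyIn A (λ i → E i j)))     ≡⟨ *-distribˡ-sum 5 (λ j → 𝟙 (anyIn A (λ i → E i j))) ⟩
    sum (λ j → 5 *ℕ 𝟙 (anyIn A (λ i → E i j)))     ≤⟨ sum-mono-≤ column≥ ⟩
    sum (λ j → sum (λ i → weight i j))             ≡⟨ ∑-comm weight ⟨
    sum (λ i → sum (weight i))                     ≤⟨ sum-mono-≤ row≤ ⟩
    sum (λ i → 9 *ℕ 𝟙 (lookup A i))                ≡⟨ *-distribˡ-sum 9 (𝟙 ∘ lookup A) ⟨
    9 *ℕ sum (𝟙 ∘ lookup A)                        ≡⟨ cong (9 *ℕ_) (∣lookup∣ A) ⟨
    9 *ℕ ∣ A ∣                                     ∎
    where open ℕ.≤-Reasoning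

-- Induction on the set to be covered

-- The graph stays fixed and only `A` shrinks. As expansion is assumed for all nonempty sets, it
-- passes to `A ─ S` unchanged, and it contradicts the discharging bound whenever nothing is
-- removable.
cover-exists : (E : BipGraph m n) → (∀ i → degL E i ≤ 3) →
  (∀ A → Nonempty A → 9 *ℕ ∣ A ∣ <ℕ 5 *ℕ ∣ nbhd E A ∣) → ∀ A → ∃ (Cover E A)
cover-exists E degree expanding A = go A (⊂-wellFounded A)
  where
  go : ∀ A → Acc _ A → ∃ (Cover E A)
  go A (acc rec) with nonempty? A
  ... | no empty = (λ _ _ → false) , record
    { within  = λ ()
    ; edge    = λ ()
    ; ends    = λ i∈A → contradiction (_ , i∈A) empty
    ; sharing = λ ()
    }
  ... | yes A≢∅ = reduce removable
    where
    open Reduction E A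

    removable : Removable
    removable with twoPrivate? | sharedPair?
    ... | yes two  | _          = twoPrivate⇒removable two
    ... | no _     | yes shared = sharedPair⇒removable shared
    ... | no ¬two  | no ¬shared = contradiction
      (Discharging.5∣nbhd∣≤9∣A∣ E A degree ¬two ¬shared) (ℕ.<⇒≱ (expanding A A≢∅))

    reduce : Removable → ∃ (Cover E A)
    reduce removable =
      let x , x∈S = nonempty
          _ , coverF = go (A ─ S) (rec (p∩q≢∅⇒p─q⊂p A S (x , x∈p∩q⁺ (S⊆A x∈S , x∈S))))
      in glue S⊆A cover coverF isolated
      where open Removable removable

-- From the rational hypothesis to natural numbers

toℚᵘ-ℕtoℚ : ∀ k → toℚᵘ (ℕtoℚ k) ℚᵘ.≃ mkℚᵘ (+ k) 0
toℚᵘ-ℕtoℚ k = ℚ.toℚᵘ-fromℚᵘ (mkℚᵘ (+ k) 0)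

-- Here 45/23 is 2 - 1/23, a lower bound for 2 - ε. Denominators are cleared in `ℚᵘ`, where no gcd
-- blocks computation.
45/23-expanding : ∀ {ε} → ε < oneOver23 → ∀ a b →
  (twoℚ - ε) * ℕtoℚ a ≤ℚ ℕtoℚ b → 45 *ℕ a ≤ 23 *ℕ b
45/23-expanding {ε} ε<1/23 a b expansion = ℤ.drop‿+≤+ (begin
  + (45 *ℕ a)             ≡⟨ ℤ.pos-* 45 a ⟩
  + 45 ℤ.* + a            ≡⟨ ℤ.*-identityʳ (+ 45 ℤ.* + a) ⟨
  + 45 ℤ.* + a ℤ.* + 1    ≤⟨ ℚᵘ.drop-*≤* unnormalised ⟩
  + b ℤ.* + 23            ≡⟨ ℤ.*-comm (+ b) (+ 23) ⟩
  + 23 ℤ.* + b            ≡⟨ ℤ.pos-* 23 b ⟨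
  + (23 *ℕ b)             ∎)
  where
  open ℤ.≤-Reasoning

  45/23 : ℚ
  45/23 = twoℚ - oneOver23

  45/23≤2-ε : 45/23 ≤ℚ twoℚ - ε
  45/23≤2-ε = ℚ.+-monoʳ-≤ twoℚ (ℚ.neg-antimono-≤ (ℚ.<⇒≤ ε<1/23))

  normalised : 45/23 * ℕtoℚ a ≤ℚ ℕtoℚ b
  normalised = ℚ.≤-trans (ℚ.*-monoʳ-≤-nonNeg (ℕtoℚ a) {{ℚ.normalize-nonNeg a 1}} 45/23≤2-ε) expansion

  -- `mkℚᵘ` stores the denominator minus one: 22 and 0 stand for 23 and 1.
  unnormalised : mkℚᵘ (+ 45) 22 ℚᵘ.* mkℚᵘ (+ a) 0 ℚᵘ.≤ mkℚᵘ (+ b) 0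
  unnormalised =
    ℚᵘ.≤-respˡ-≃ (ℚᵘ.≃-trans (ℚ.toℚᵘ-homo-* 45/23 (ℕtoℚ a)) (ℚᵘ.*-congˡ {mkℚᵘ (+ 45) 22} (toℚᵘ-ℕtoℚ a)))
      (ℚᵘ.≤-respʳ-≃ (toℚᵘ-ℕtoℚ b) (ℚ.toℚᵘ-mono-≤ normalised))

theorem1 : (ε : ℚ) → ε < oneOver23 →
    (m n : ℕ) (E : BipGraph m n) →
    ((i : Fin m) → degL E i ≤ 3) →
    ((A : Subset m) → (twoℚ - ε) * ℕtoℚ ∣ A ∣ ≤ℚ ℕtoℚ ∣ nbhd E A ∣) →
    Σ (BipGraph m n) λ F → Is24MatchingCoveringL E F
theorem1 ε ε<1/23 m n E degree expansion =
  let F , cover = cover-exists E degree expanding ⊤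
  in F , (λ _ _ → Cover.edge cover) , acyclic cover , small-components cover , degL≡2 cover
  where
  expanding : ∀ A → Nonempty A → 9 *ℕ ∣ A ∣ <ℕ 5 *ℕ ∣ nbhd E A ∣
  expanding A (x , x∈A) = ℕ.*-cancelˡ-< 23 (9 *ℕ ∣ A ∣) (5 *ℕ ∣ nbhd E A ∣) (begin-strict
    23 *ℕ (9 *ℕ ∣ A ∣)             ≡⟨ ℕ.*-assoc 23 9 ∣ A ∣ ⟨
    -- Strictness comes from 207 < 225, that is 9/5 < 45/23, and from `A` having the element `x`.
    207 *ℕ ∣ A ∣                   <⟨ ℕ.*-monoˡ-< ∣ A ∣ {{ℕ.>-nonZero (ℕ.≤-<-trans z≤n (x∈p⇒∣p-x∣<∣p∣ x∈A))}} (ℕ.m≤m+n 208 17) ⟩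
    225 *ℕ ∣ A ∣                   ≡⟨ ℕ.*-assoc 5 45 ∣ A ∣ ⟩
    5 *ℕ (45 *ℕ ∣ A ∣)             ≤⟨ ℕ.*-monoʳ-≤ 5 (45/23-expanding ε<1/23 ∣ A ∣ ∣ nbhd E A ∣ (expansion A)) ⟩
    5 *ℕ (23 *ℕ ∣ nbhd E A ∣)      ≡⟨ ℕ.*-assoc 5 23 ∣ nbhd E A ∣ ⟨
    115 *ℕ ∣ nbhd E A ∣            ≡⟨ ℕ.*-assoc 23 5 ∣ nbhd E A ∣ ⟩
    23 *ℕ (5 *ℕ ∣ nbhd E A ∣)      ∎)
    where open ℕ.≤-Reasoning
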